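{- Assuming classical logic, there is no continuous functional that takes codes for two continuous injections $f, g : 2 \times \mathbb{N}_\infty \to 2 \times \mathbb{N}_\infty$ to codes for a bijection $h : 2 \times \mathbb{N}_\infty \to 2 \times \mathbb{N}_\infty$ and its inverse $h^{ -1}$ such that $h \subseteq \bigcup_{m \in \mathbb{Z}} R^{f,g}_m$.
   Context: $\mathbb{N}_\infty \subseteq 2^{\mathbb{N}}$ is the set of bit sequences containing at most one $1$, with the subspace topology; $2 = \{0,1\}$ is discrete. $2 \times \mathbb{N}_\infty$ is regarded as a subset of $\mathbb{N}^{\mathbb{N}}$ via $(i,x) \mapsto i x$ (prepending $i$ to $x$). Codes are those of type-2 computability (Kleene's second algebra): an $e \in \mathbb{N}^{\mathbb{N}}$ codes the partial continuous function $q \mapsto e \cdot q$ on $\mathbb{N}^{\mathbb{N}}$, where $(e\cdot q)(n) = e(\langle n, q_0, \ldots, q_{k-1}\rangle) - 1$ for the least $k$ such that $e(\langle n, q_0,\ldots,q_{k-1}\rangle) > 0$ ($\langle\cdots\rangle$ being a fixed coding of finite sequences of naturals as naturals), and $e \cdot q$ is defined iff such a $k$ exists for all $n$. $e$ is a code for $F : 2 \times \mathbb{N}_\infty \to 2\times \mathbb{N}_\infty$ if $e \cdot z$ is defined and equal to $F(z)$ for all $z \in 2 \times \mathbb{N}_\infty$. A continuous functional as in the claim is a partial continuous map $\mathbb{N}^{\mathbb{N}} \times \mathbb{N}^{\mathbb{N}} \rightharpoonup \mathbb{N}^{\mathbb{N}} \times \mathbb{N}^{\mathbb{N}}$ defined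 at least on all pairs of codes for continuous injections; the resulting $h$ may depend on the codes and not only on $f$ and $g$. For injections $f, g : X \to X$ and $m \in \mathbb{Z}$, $R^{f,g}_m \subseteq X \times X$ is the partial injection $f \circ (g \circ f)^m$: for $m \ge 0$, $(x,y) \in R^{f,g}_m$ iff $y = f((g\circ f)^m(x))$; for $m < 0$, $(x,y) \in R^{f,g}_m$ iff $x = g((f \circ g)^{ -m-1}(y))$. Functions are identified with their graphs. -}

module Defs where

open import Data.Fin.Base using (Fin; toℕ)
open import Data.Fin.Patterns using (1F)
open import Data.Integer.Base using (ℤ; +_; -[1+_])
open import Data.List.Base using (List; _∷_; applyUpTo)
open import Data.Nat.Base using (ℕ; zero; suc; _∸_; _<_; _>_)
open import Data.Nat.GeneralisedArithmetic using (fold)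
open import Data.Product.Base using (Σ-syntax; ∃-syntax; _×_; _,_; proj₁; proj₂)
open import Data.Product.Relation.Binary.Pointwise.NonDependent using (×-setoid)
open import Function.Base using (_∘_)
open import Function.Bundles using (_↣_; Injection)
open import Level using (0ℓ)
open import Relation.Binary.Bundles using (Setoid)
open import Relation.Binary.Core using (Rel)
import Relation.Binary.Construct.On as On
open import Relation.Binary.PropositionalEquality using (_≡_; setoid; _→-setoid_)
open import Relation.Nullary.Negation.Core using (¬_)
open import Relation.Unary using (Pred; _∈_)

Baire : Set
Baire = ℕ → ℕ

-- The basic open sets of ℕ^ℕ are the balls { r | q ≈[ n ] r }.
_≈[_]_ : Baire → ℕ → Baire → Set
q ≈[ n ] r = ∀ i → i < n → q i ≡ r i

-- The product topology on ℕ^ℕ × ℕ^ℕ.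
_≈²[_]_ : Baire × Baire → ℕ → Baire × Baire → Set
(q , q′) ≈²[ n ] (r , r′) = q ≈[ n ] r × q′ ≈[ n ] r′

-- Partial maps ℕ^ℕ × ℕ^ℕ ⇀ ℕ^ℕ × ℕ^ℕ that are continuous for the subspace
-- topology on an arbitrary domain. Continuity also makes the value
-- independent, up to pointwise equality, of the proof of membership in Dom.
record PartialContinuousMap : Set₁ where
  field
    Dom        : Pred (Baire × Baire) 0ℓ
    apply      : ∀ p → p ∈ Dom → Baire × Baire
    continuous : ∀ p (d : p ∈ Dom) n →
                 ∃[ k ] (∀ p′ (d′ : p′ ∈ Dom) →
                   p ≈²[ k ] p′ → apply p d ≈²[ n ] apply p′ d′)

AtMostOne1 : Pred (ℕ → Fin 2) 0ℓ
AtMostOne1 x = ∀ i j → x i ≡ 1F → x j ≡ 1F → i ≡ j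

-- Two elements are equal when their bit sequences are pointwise equal.
ℕ∞ : Setoid 0ℓ 0ℓ
ℕ∞ = On.setoid {B = Σ[ x ∈ (ℕ → Fin 2) ] AtMostOne1 x} (ℕ →-setoid Fin 2) proj₁

2×ℕ∞ : Setoid 0ℓ 0ℓ
2×ℕ∞ = ×-setoid (setoid (Fin 2)) ℕ∞

X : Set
X = Setoid.Carrier 2×ℕ∞

-- The inclusion of 2 × ℕ∞ in ℕ^ℕ, (i , x) ↦ i x.
ι : X → Baire
ι (i , x) zero    = toℕ i
ι (i , x) (suc n) = toℕ (proj₁ x n)

Continuous : (X → X) → Set
Continuous f = ∀ z n → ∃[ k ] (∀ z′ → ι z ≈[ k ] ι z′ → ι (f z) ≈[ n ] ι (f z′))

-- ⟨_⟩ is the fixed coding of finite sequences; being a coding, it is only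
-- required to be injective.
module Kleene (coding : List ℕ ↣ ℕ) where

  ⟨_⟩ : List ℕ → ℕ
  ⟨_⟩ = Injection.to coding

  -- e(⟨n, q₀, …, q_{k-1}⟩)
  query : Baire → Baire → ℕ → ℕ → ℕ
  query e q n k = e ⟨ n ∷ applyUpTo q k ⟩

  LeastPositive : (ℕ → ℕ) → Pred ℕ 0ℓ
  LeastPositive s k = s k > 0 × (∀ j → j < k → ¬ (s j > 0))

  -- "e · q is defined and equal to r".
  _·_↦_ : Baire → Baire → Baire → Set
  e · q ↦ r = ∀ n → ∃[ k ] (LeastPositive (query e q n) k × query e q n k ∸ 1 ≡ r n)

  IsCode : Baire → (X → X) → Set
  IsCode e F = ∀ z → e · ι z ↦ ι (F z)

-- R f g m is the partial injection f ∘ (g ∘ f)^m as a relation. Note that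
-- the integer -[1+ n ] is m = -(1 + n), so that -m-1 = n.
R : (f g : X → X) → ℤ → Rel X 0ℓ
R f g (+ n)    x y = y ≈ f (fold x (g ∘ f) n)
  where open Setoid 2×ℕ∞
R f g -[1+ n ] x y = x ≈ g (fold y (f ∘ g) n)
  where open Setoid 2×ℕ∞

{-# OPTIONS --safe #-}

-- Identify 2 × ℕ∞ with the two-point compactification of ℤ, the side 0
-- holding the negative half. Start from f = the translation of ℤ and g = id.
-- Beyond any finite precision, this pair can be perturbed in two ways: by
-- making f, or instead g, omit a far away point (0 , K) of the side 0. If Φ
-- existed, then by continuity and compactness its two answers h₁ and h₂ would
-- send every point to the same side. But the cycles beyond K force h₁ = id and
-- h₂ = f there, so that h₂ ∘ h₁⁻¹ would inject the K + 1 points (0 , j) with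
-- j ≤ K into the K points (0 , j) with j < K.
module Submission where

open import Axiom.ExcludedMiddle using (ExcludedMiddle)
open import Data.Empty using (⊥)
open import Data.Fin.Base using (Fin; toℕ; fromℕ<)
open import Data.Fin.Patterns using (0F; 1F)
open import Data.Fin.Properties
  using (toℕ-injective; toℕ<n; toℕ-fromℕ<; pigeonhole)
  renaming (<⇒≢ to <⇒≢ᶠ)
open import Data.Integer.Base using (+_; -[1+_])
open import Data.List.Base using (List; _∷_; applyUpTo; length)
open import Data.List.Properties using (∷-injective; length-applyUpTo)
open import Data.Maybe.Base as Maybe using (Maybe; just; nothing)
open import Data.Maybe.Properties using (just-injective)
open import Data.Maybe.Relation.Unary.All as All using (All; just; nothing)
open import Data.Nat.Base using (ℕ; zero; suc; _+_; _∸_; _⊔_; _≤_; _<_; _>_; z≤n; s≤s; s≤s⁻¹)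
open import Data.Nat.GeneralisedArithmetic using (fold)
open import Data.Nat.Properties
open import Data.Product.Base using (Σ-syntax; ∃; ∃-syntax; _×_; _,_; proj₁; proj₂)
open import Data.Sum.Base using (_⊎_; inj₁; inj₂)
open import Function.Base using (_∘_; id)
open import Function.Bundles using (_↣_; Injection; Inverse)
open import Level using (0ℓ)
open import Relation.Binary.Bundles using (Setoid)
open import Relation.Binary.Definitions using (tri<; tri≈; tri>)
open import Relation.Binary.PropositionalEquality
  using (_≡_; refl; sym; trans; cong; cong₂; subst; module ≡-Reasoning)
import Relation.Binary.Reasoning.Setoid
open import Relation.Nullary.Decidable.Core using (Dec; yes; no)
open import Relation.Nullary.Negation.Core using (¬_; contradiction)
open import Relation.Unary using (_∈_)
open import Defs

open Setoid 2×ℕ∞ using (_≈_) renaming (refl to ≈-refl; sym to ≈-sym)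
module ≈-Reasoning = Relation.Binary.Reasoning.Setoid 2×ℕ∞

-- Finite bounds and prefixes.

uniform-bound : {Q : ℕ → ℕ → Set} → (∀ {m N N′} → N ≤ N′ → Q m N → Q m N′) →
                (∀ m → ∃ (Q m)) → ∀ k → ∃[ N ] (∀ m → m < k → Q m N)
uniform-bound mono q zero = 0 , λ _ ()
uniform-bound {Q} mono q (suc k) = N₁ ⊔ N₂ , bound
  where
  N₁ = proj₁ (uniform-bound mono q k)
  N₂ = proj₁ (q k)
  bound : ∀ m → m < suc k → Q m (N₁ ⊔ N₂)
  bound m m<1+k with m<1+n⇒m<n∨m≡n m<1+k
  ... | inj₁ m<k  = mono (m≤m⊔n N₁ N₂) (proj₂ (uniform-bound mono q k) m m<k)
  ... | inj₂ refl = mono (m≤n⊔m N₁ N₂) (proj₂ (q k))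

applyUpTo-cong : {q r : Baire} → ∀ k → q ≈[ k ] r → applyUpTo q k ≡ applyUpTo r k
applyUpTo-cong zero    _   = refl
applyUpTo-cong (suc k) q≈r =
  cong₂ _∷_ (q≈r 0 (s≤s z≤n)) (applyUpTo-cong k λ i i<k → q≈r (suc i) (s≤s i<k))

applyUpTo-injective : {q r : Baire} → ∀ k → applyUpTo q k ≡ applyUpTo r k → q ≈[ k ] r
applyUpTo-injective (suc k) eq zero    _   = proj₁ (∷-injective eq)
applyUpTo-injective (suc k) eq (suc i) i<k =
  applyUpTo-injective k (proj₂ (∷-injective eq)) i (s≤s⁻¹ i<k)

-- The points of 2 × ℕ∞

-- nothing stands for ∞, and just m for the sequence with its 1 at index m.
P : Set
P = Fin 2 × Maybe ℕ

bit : Maybe ℕ → ℕ → Fin 2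
bit nothing        _       = 0F
bit (just zero)    zero    = 1F
bit (just zero)    (suc _) = 0F
bit (just (suc _)) zero    = 0F
bit (just (suc m)) (suc j) = bit (just m) j

bit-diagonal : ∀ m → bit (just m) m ≡ 1F
bit-diagonal zero    = refl
bit-diagonal (suc m) = bit-diagonal m

bit≡1⇒ : ∀ m j → bit m j ≡ 1F → m ≡ just j
bit≡1⇒ (just zero)    zero    _  = refl
bit≡1⇒ (just (suc m)) (suc j) eq = cong (Maybe.map suc) (bit≡1⇒ (just m) j eq)

bit-before : ∀ {k m} → All (k ≤_) m → ∀ j → j < k → bit m j ≡ 0F
bit-before nothing                  _       _         = refl
bit-before (just {zero} z≤n)        _       ()
bit-before (just {suc _} _)         zero    _         = refl
bit-before (just {suc m} (s≤s k≤m)) (suc j) (s≤s j<k) = bit-before (just k≤m) j j<k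

Fin2-≡ : ∀ {a b : Fin 2} → (a ≡ 1F → b ≡ 1F) → (b ≡ 1F → a ≡ 1F) → a ≡ b
Fin2-≡ {0F} {0F} _ _ = refl
Fin2-≡ {0F} {1F} _ g = g refl
Fin2-≡ {1F} {0F} f _ = sym (f refl)
Fin2-≡ {1F} {1F} _ _ = refl

-- A 1 seen below index `k` in one sequence also occurs in the other, which pins both down. If none
-- is seen, both points lie at `k` or beyond, possibly at ∞.
bits-determine : ∀ k m m′ → (∀ j → j < k → bit m j ≡ bit m′ j) →
                 m ≡ m′ ⊎ (All (k ≤_) m × All (k ≤_) m′)
bits-determine k nothing nothing _ = inj₁ refl
bits-determine k nothing (just b) eq with <-≤-connex b k
... | inj₁ b<k = inj₁ (bit≡1⇒ nothing b (trans (eq b b<k) (bit-diagonal b)))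
... | inj₂ k≤b = inj₂ (nothing , just k≤b)
bits-determine k (just a) m′ eq with <-≤-connex a k
... | inj₁ a<k = inj₁ (sym (bit≡1⇒ m′ a (trans (sym (eq a a<k)) (bit-diagonal a))))
bits-determine k (just a) nothing  eq | inj₂ k≤a = inj₂ (just k≤a , nothing)
bits-determine k (just a) (just b) eq | inj₂ k≤a with <-≤-connex b k
... | inj₁ b<k = inj₁ (bit≡1⇒ (just a) b (trans (eq b b<k) (bit-diagonal b)))
... | inj₂ k≤b = inj₂ (just k≤a , just k≤b)

point : P → X
point (i , m) = i , bit m , λ j j′ eq eq′ →
  just-injective (trans (sym (bit≡1⇒ m j eq)) (bit≡1⇒ m j′ eq′))

ι-cong : ∀ z z′ → z ≈ z′ → ∀ n → ι z n ≡ ι z′ n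
ι-cong _ _ (refl , _) zero    = refl
ι-cong _ _ (_ , eq)   (suc n) = cong toℕ (eq n)

ι-point-determines : ∀ k i m i′ m′ → ι (point (i , m)) ≈[ suc k ] ι (point (i′ , m′)) →
                     i ≡ i′ × (m ≡ m′ ⊎ (All (k ≤_) m × All (k ≤_) m′))
ι-point-determines k i m i′ m′ eq =
    toℕ-injective (eq 0 (s≤s z≤n))
  , bits-determine k m m′ (λ j j<k → toℕ-injective (eq (suc j) (s≤s j<k)))

ι-point-far : ∀ k i {m m′} → All (k ≤_) m → All (k ≤_) m′ →
              ι (point (i , m)) ≈[ suc k ] ι (point (i , m′))
ι-point-far k i _ _  zero    _         = refl
ι-point-far k i a a′ (suc n) (s≤s n<k) =
  cong toℕ (trans (bit-before a n n<k) (sym (bit-before a′ n n<k)))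

point-injective : ∀ p q → point p ≈ point q → p ≡ q
point-injective (i , nothing) (_ , nothing) (refl , _) = refl
point-injective (i , just a) (_ , m) (refl , eq) =
  cong (i ,_) (sym (bit≡1⇒ m a (trans (sym (eq a)) (bit-diagonal a))))
point-injective (i , nothing) (_ , just b) (refl , eq) =
  cong (i ,_) (bit≡1⇒ nothing b (trans (eq b) (bit-diagonal b)))

-- Maps of P

-- From index 1 on, `φ` keeps the side and lowers the index by at most one, as `shift` does on side
-- 0. Taking all `k` at once, this forces `φ` to fix both points at infinity.
Nonexpanding : (P → P) → Set
Nonexpanding φ = ∀ i m k → All (suc k ≤_) m →
  proj₁ (φ (i , m)) ≡ i × All (k ≤_) (proj₂ (φ (i , m)))

-- With `(0F , just m)` read as -(m+1) and `(1F , just m)` as m, this is the successor on ℤ,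
-- extended to fix both infinities.
shift : P → P
shift (i  , nothing)      = i  , nothing
shift (0F , just zero)    = 1F , just zero
shift (0F , just (suc m)) = 0F , just m
shift (1F , just m)       = 1F , just (suc m)

shift⁻¹ : P → P
shift⁻¹ (i  , nothing)      = i  , nothing
shift⁻¹ (0F , just m)       = 0F , just (suc m)
shift⁻¹ (1F , just zero)    = 0F , just zero
shift⁻¹ (1F , just (suc m)) = 1F , just m

shift⁻¹-shift : ∀ p → shift⁻¹ (shift p) ≡ p
shift⁻¹-shift (_  , nothing)      = refl
shift⁻¹-shift (0F , just zero)    = refl
shift⁻¹-shift (0F , just (suc _)) = refl
shift⁻¹-shift (1F , just _)       = refl

shift-injective : ∀ {p q} → shift p ≡ shift q → p ≡ q
shift-injective {p} {q} eq =
  trans (sym (shift⁻¹-shift p)) (trans (cong shift⁻¹ eq) (shift⁻¹-shift q))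

-- The increasing enumeration of ℕ ∖ {K}.
skipℕ : ℕ → ℕ → ℕ
skipℕ zero    m       = suc m
skipℕ (suc K) zero    = zero
skipℕ (suc K) (suc m) = suc (skipℕ K m)

skipℕ-injective : ∀ K {m n} → skipℕ K m ≡ skipℕ K n → m ≡ n
skipℕ-injective zero                    refl = refl
skipℕ-injective (suc K) {zero}  {zero}  _    = refl
skipℕ-injective (suc K) {suc m} {suc n} eq   = cong suc (skipℕ-injective K (suc-injective eq))

m≤skipℕ : ∀ K m → m ≤ skipℕ K m
m≤skipℕ zero    m       = n≤1+n m
m≤skipℕ (suc K) zero    = z≤n
m≤skipℕ (suc K) (suc m) = s≤s (m≤skipℕ K m)

skipℕ-beyond : ∀ {K m} → K ≤ m → skipℕ K m ≡ suc m
skipℕ-beyond z≤n       = refl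
skipℕ-beyond (s≤s K≤m) = cong suc (skipℕ-beyond K≤m)

bit-skipℕ : ∀ K m j → j < K → bit (just m) j ≡ bit (just (skipℕ K m)) j
bit-skipℕ (suc K) zero    _       _         = refl
bit-skipℕ (suc K) (suc m) zero    _         = refl
bit-skipℕ (suc K) (suc m) (suc j) (s≤s j<K) = bit-skipℕ K m j j<K

skip : ℕ → P → P
skip K (i  , nothing) = i  , nothing
skip K (0F , just m)  = 0F , just (skipℕ K m)
skip K (1F , just m)  = 1F , just m

skip-injective : ∀ K {p q} → skip K p ≡ skip K q → p ≡ q
skip-injective K {_  , nothing} {_  , nothing} refl = refl
skip-injective K {_  , nothing} {0F , just _}  ()
skip-injective K {_  , nothing} {1F , just _}  ()
skip-injective K {0F , just _}  {_  , nothing} ()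
skip-injective K {1F , just _}  {_  , nothing} ()
skip-injective K {0F , just m}  {0F , just n}  eq   =
  cong (λ j → 0F , just j) (skipℕ-injective K (just-injective (cong proj₂ eq)))
skip-injective K {0F , just _}  {1F , just _}  ()
skip-injective K {1F , just _}  {0F , just _}  ()
skip-injective K {1F , just _}  {1F , just _}  refl = refl

-- Indices below `K` are unmoved and the others stay at `K` or beyond, so the bits below `K` agree.
-- Entry 0 of `ι` is the side, whence `n ≤ K`.
ι-skip : ∀ K p n → n ≤ K → ι (point p) n ≡ ι (point (skip K p)) n
ι-skip K (_  , nothing) zero    _   = refl
ι-skip K (_  , nothing) (suc n) _   = refl
ι-skip K (0F , just m)  zero    _   = refl
ι-skip K (0F , just m)  (suc n) n<K = cong toℕ (bit-skipℕ K m n n<K)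
ι-skip K (1F , just m)  zero    _   = refl
ι-skip K (1F , just m)  (suc n) _   = refl

id-nonexpanding : Nonexpanding id
id-nonexpanding i m k far = refl , All.map <⇒≤ far

shift-nonexpanding : Nonexpanding shift
shift-nonexpanding i  nothing        k nothing           = refl , nothing
shift-nonexpanding 0F (just (suc m)) k (just (s≤s k≤m)) = refl , just k≤m
shift-nonexpanding 1F (just m)       k (just k<m)        = refl , just (m≤n⇒m≤1+n (<⇒≤ k<m))

skip-far : ∀ K i {m k} → All (k ≤_) m →
           proj₁ (skip K (i , m)) ≡ i × All (k ≤_) (proj₂ (skip K (i , m)))
skip-far K i  nothing            = refl , nothing
skip-far K 0F (just {m} k≤m)     = refl , just (≤-trans k≤m (m≤skipℕ K m))
skip-far K 1F (just k≤m)         = refl , just k≤m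

skip-nonexpanding : ∀ K → Nonexpanding (skip K)
skip-nonexpanding K i m k far = skip-far K i (All.map <⇒≤ far)

skip∘shift-nonexpanding : ∀ K → Nonexpanding (skip K ∘ shift)
skip∘shift-nonexpanding K i m k far with shift (i , m) | shift-nonexpanding i m k far
... | .i , _ | refl , far′ = skip-far K i far′

-- Counting, and cycles of length two.

-- H₂ ∘ H₁⁻¹ sends no (0 , j) with j ≤ K to (0 , ∞) or to (0 , m) with m ≥ K,
-- because those are the images under H₂ of fixed points of H₁ beyond K.
no-side-preserving-pair : ∀ K (H₁ H₁⁻¹ H₂ : P → P) →
  (∀ p → H₁ (H₁⁻¹ p) ≡ p) → (∀ {p q} → H₂ p ≡ H₂ q → p ≡ q) →
  (∀ p → proj₁ (H₁ p) ≡ proj₁ (H₂ p)) →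
  (∀ p → skip K (shift p) ≡ p → H₁ p ≡ p × H₂ p ≡ shift p) → ⊥
no-side-preserving-pair K H₁ H₁⁻¹ H₂ H₁-inverse H₂-injective same-side cycles =
  let i , j , i<j , eq = pigeonhole ≤-refl (λ j → fromℕ< (proj₁ (proj₂ (image j)))) in
  contradiction (collide eq) (<⇒≢ᶠ i<j)
  where
  z : Fin (suc K) → P
  z j = H₁⁻¹ (0F , just (toℕ j))
  -- Injectivity of `H₂` identifies `z j` with `p`, and `H₁` fixes `p`.
  preimage : ∀ {j p} → skip K (shift p) ≡ p → H₂ (z j) ≡ shift p → p ≡ (0F , just (toℕ j))
  preimage {j} {p} cycle eq = begin
    p                  ≡⟨ proj₁ (cycles p cycle) ⟨
    H₁ p               ≡⟨ cong H₁ (H₂-injective (trans eq (sym (proj₂ (cycles p cycle))))) ⟨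
    H₁ (z j)           ≡⟨ H₁-inverse _ ⟩
    (0F , just (toℕ j)) ∎
    where open ≡-Reasoning
  image : ∀ j → ∃[ m ] (m < K × H₂ (z j) ≡ (0F , just m))
  image j
    -- `H₁ (z j)` is on side 0, hence so is `H₂ (z j)`.
    with H₂ (z j) in eq
       | trans (sym (cong proj₁ (H₁-inverse (0F , just (toℕ j))))) (same-side (z j))
  ... | .0F , nothing | refl with () ← preimage {j} {0F , nothing} refl eq
  ... | .0F , just m  | refl with <-≤-connex m K
  ...   | inj₁ m<K = m , m<K , refl
  -- Here `(0F , just (suc m))` lies on a cycle and `shift` sends it to `(0F , just m)`, so `suc m`
  -- would equal `toℕ j`, which is at most `K`.
  ...   | inj₂ K≤m = contradiction
    (subst (_≤ K) (sym 1+m≡j) (s≤s⁻¹ (toℕ<n j))) (<⇒≱ (s≤s K≤m))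
    where
    1+m≡j : suc m ≡ toℕ j
    1+m≡j = just-injective (cong proj₂
      (preimage {j} {0F , just (suc m)} (cong (λ n → 0F , just n) (skipℕ-beyond K≤m)) eq))
  collide : ∀ {i j} → fromℕ< (proj₁ (proj₂ (image i))) ≡ fromℕ< (proj₁ (proj₂ (image j))) → i ≡ j
  collide {i} {j} eq with image i | image j
  ... | m , m<K , eqᵢ | n , n<K , eqⱼ = toℕ-injective (just-injective (cong proj₂
    (trans (sym (H₁-inverse _)) (trans (cong H₁ (H₂-injective zᵢ≡zⱼ)) (H₁-inverse _)))))
    where
    m≡n : m ≡ n
    m≡n = trans (sym (toℕ-fromℕ< m<K)) (trans (cong toℕ eq) (toℕ-fromℕ< n<K))
    zᵢ≡zⱼ : H₂ (z i) ≡ H₂ (z j)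
    zᵢ≡zⱼ = trans eqᵢ (trans (cong (λ n → 0F , just n) m≡n) (sym eqⱼ))

-- For `m ≥ 0`, the powers of `g ∘ f` fix `x`, leaving only the last `f`. For `m < 0`, cancelling
-- `g` and `f` alternately reduces the equation to `y ≈ f x`.
R-2-cycle : (f g : Injection 2×ℕ∞ 2×ℕ∞) → let f′ = Injection.to f; g′ = Injection.to g in
            ∀ {x y} m → g′ (f′ x) ≡ x → R f′ g′ m x y → y ≈ f′ x
R-2-cycle f g {x} {y} m gfx≡x = go m
  where
  open Injection f using () renaming (to to f′; injective to f-injective)
  open Injection g using () renaming (to to g′; injective to g-injective)
  open ≈-Reasoning
  fold-fixed : ∀ n → fold x (g′ ∘ f′) n ≡ x
  fold-fixed zero    = refl
  fold-fixed (suc n) = trans (cong (g′ ∘ f′) (fold-fixed n)) gfx≡x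
  unfold : ∀ n → x ≈ g′ (fold y (f′ ∘ g′) n) → y ≈ f′ x
  unfold n eq = g-cancel n (g-injective {fold y (f′ ∘ g′) n} {f′ x} (begin
    g′ (fold y (f′ ∘ g′) n) ≈⟨ eq ⟨
    x                       ≡⟨ gfx≡x ⟨
    g′ (f′ x)               ∎))
    where
    g-cancel : ∀ n → fold y (f′ ∘ g′) n ≈ f′ x → y ≈ f′ x
    g-cancel zero    eq = eq
    g-cancel (suc n) eq = unfold n (≈-sym {g′ (fold y (f′ ∘ g′) n)} {x} (f-injective eq))
  go : ∀ m → R f′ g′ m x y → y ≈ f′ x
  go (+ n) eq = begin
    y                         ≈⟨ eq ⟩
    f′ (fold x (g′ ∘ f′) n)   ≡⟨ cong f′ (fold-fixed n) ⟩
    f′ x                      ∎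
  go -[1+ n ] eq = unfold n eq

-- Classical classification of points, and compactness.

module Classical (em : ExcludedMiddle 0ℓ) where

  index : {x : ℕ → Fin 2} → Dec (∃[ n ] x n ≡ 1F) → Maybe ℕ
  index (yes (n , _)) = just n
  index (no _)        = nothing

  bit-index : ∀ {x} → AtMostOne1 x → (d : Dec (∃[ n ] x n ≡ 1F)) →
              ∀ j → x j ≡ bit (index d) j
  bit-index {x} x≤1 (yes (n , xn≡1)) j = Fin2-≡
    (λ xj≡1 → subst (λ i → bit (just n) i ≡ 1F) (x≤1 n j xn≡1 xj≡1) (bit-diagonal n))
    (λ eq → subst (λ i → x i ≡ 1F) (just-injective (bit≡1⇒ (just n) j eq)) xn≡1)
  bit-index x≤1 (no ∄1) j = Fin2-≡ (λ xj≡1 → contradiction (j , xj≡1) ∄1) λ ()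

  -- Excluded middle locates the 1 or rules it out; this inverts `point` and so identifies `X`, up
  -- to `≈`, with `P`.
  classify : X → P
  classify (i , x , _) = i , index (em {∃[ n ] x n ≡ 1F})

  ≈-point-classify : ∀ z → z ≈ point (classify z)
  ≈-point-classify (i , x , x≤1) = refl , bit-index x≤1 em

  classify-cong : ∀ z z′ → z ≈ z′ → classify z ≡ classify z′
  classify-cong z z′ z≈z′ = point-injective _ _ (begin
    point (classify z)  ≈⟨ ≈-point-classify z ⟨
    z                   ≈⟨ z≈z′ ⟩
    z′                  ≈⟨ ≈-point-classify z′ ⟩
    point (classify z′) ∎)
    where open ≈-Reasoning

  classify-injective : ∀ z z′ → classify z ≡ classify z′ → z ≈ z′
  classify-injective z z′ eq = begin
    z                   ≈⟨ ≈-point-classify z ⟩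
    point (classify z)  ≡⟨ cong point eq ⟩
    point (classify z′) ≈⟨ ≈-point-classify z′ ⟨
    z′                  ∎
    where open ≈-Reasoning

  classify-point : ∀ p → classify (point p) ≡ p
  classify-point p =
    sym (point-injective p (classify (point p)) (≈-point-classify (point p)))

  -- On each side, the neighbourhood of the point at infinity contains every index from some `k` on.
  -- The finitely many indices below `k` get a common bound, and monotonicity allows passing to the
  -- maximum.
  compactness : {Q : ℕ → X → Set} → (∀ {N N′ z} → N ≤ N′ → Q N z → Q N′ z) →
                (∀ z → ∃[ k ] ∃[ N ] (∀ z′ → ι z ≈[ k ] ι z′ → Q N z′)) →
                ∃[ N ] (∀ z → Q N z)
  compactness {Q} mono local = proj₁ (side 0F) ⊔ proj₁ (side 1F) , λ where
      z@(0F , _) → mono {z = z} (m≤m⊔n _ _) (proj₂ (side 0F) z refl)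
      z@(1F , _) → mono {z = z} (m≤n⊔m (proj₁ (side 0F)) _) (proj₂ (side 1F) z refl)
    where
    side : ∀ i → ∃[ N ] (∀ z → proj₁ z ≡ i → Q N z)
    side i with local (point (i , nothing))
    ... | k , N∞ , q∞ = N∞ ⊔ proj₁ finite , covered
      where
      near : ∀ m → ∃[ N ] (∀ z → point (i , just m) ≈ z → Q N z)
      near m with local (point (i , just m))
      ... | _ , N , q = N , λ z eq → q z λ n _ → ι-cong _ z eq n
      finite = uniform-bound (λ N≤N′ q z eq → mono {z = z} N≤N′ (q z eq)) near k
      N = proj₁ finite
      covered : ∀ z → proj₁ z ≡ i → Q (N∞ ⊔ N) z
      covered z refl with proj₂ (classify z) | ≈-point-classify z
      ... | nothing | eq = mono {z = z} (m≤m⊔n N∞ N)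
        (q∞ z λ n _ → sym (ι-cong z (point (i , nothing)) eq n))
      ... | just m | eq with <-≤-connex m k
      ...   | inj₁ m<k = mono {z = z} (m≤n⊔m N∞ N)
        (proj₂ finite m m<k z (≈-sym {z} {point (i , just m)} eq))
      ...   | inj₂ k≤m = mono {z = z} (m≤m⊔n N∞ N)
        (q∞ z λ n n<k → trans (ι-point-far k i nothing (just k≤m) n (m<n⇒m<1+n n<k))
          (sym (ι-cong z (point (i , just m)) eq n)))

  -- The continuous maps induced by maps of P

  -- A single modulus for all the maps, so that their codes can ask the same questions. Entry `n` is
  -- the last of 1 + n entries, and one more is spent on the index that `Nonexpanding` may lose.
  Modulus : (X → X) → Set
  Modulus F = ∀ z z′ n → ι z ≈[ 2 + n ] ι z′ → ι (F z) n ≡ ι (F z′) n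

  lift : (P → P) → X → X
  lift φ = point ∘ φ ∘ classify

  lift-point : ∀ φ p → lift φ (point p) ≡ point (φ p)
  lift-point φ p = cong (point ∘ φ) (classify-point p)

  lift-injection : (φ : P → P) → (∀ {p q} → φ p ≡ φ q → p ≡ q) → Injection 2×ℕ∞ 2×ℕ∞
  lift-injection φ φ-injective = record
    { to        = lift φ
    ; cong      = λ {z} {z′} z≈z′ → begin
        lift φ z  ≡⟨ cong (point ∘ φ) (classify-cong z z′ z≈z′) ⟩
        lift φ z′ ∎
    ; injective = λ {z} {z′} →
        classify-injective z z′ ∘ φ-injective ∘ point-injective (φ (classify z)) (φ (classify z′))
    }
    where open ≈-Reasoning

  -- Points sharing 2 + n entries either coincide or lie on one side with indices at least 1 + n. In
  -- the latter case their images stay on that side with indices at least n, so they agree through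
  -- entry n.
  lift-modulus : ∀ φ → Nonexpanding φ → Modulus (lift φ)
  lift-modulus φ ne z z′ n eq = agree (classify z) (classify z′) λ j j<k →
    trans (sym (ι-cong z _ (≈-point-classify z) j))
      (trans (eq j j<k) (ι-cong z′ _ (≈-point-classify z′) j))
    where
    agree : ∀ p q → ι (point p) ≈[ 2 + n ] ι (point q) → ι (point (φ p)) n ≡ ι (point (φ q)) n
    agree (i , m) (i′ , m′) p≈q with ι-point-determines (suc n) i m i′ m′ p≈q
    ... | refl , inj₁ refl = refl
    ... | refl , inj₂ (a , a′) with φ (i , m) | φ (i , m′) | ne i m n a | ne i m′ n a′
    ...   | .i , _ | .i , _ | refl , b | refl , b′ = ι-point-far n i b b′ n ≤-refl

  continuous-lift : ∀ φ → Nonexpanding φ → Continuous (lift φ)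
  continuous-lift φ ne z n = 2 + n , λ z′ eq i i<n →
    lift-modulus φ ne z z′ i λ j j<2+i → eq j (<-trans j<2+i (s≤s (s≤s i<n)))

  lift-2-cycle : ∀ φ γ (φ-injective : ∀ {p q} → φ p ≡ φ q → p ≡ q)
                 (γ-injective : ∀ {p q} → γ p ≡ γ q → p ≡ q) (h : X → X) →
                 (∀ x → ∃[ m ] R (lift φ) (lift γ) m x (h x)) →
                 ∀ p → γ (φ p) ≡ p → classify (h (point p)) ≡ φ p
  lift-2-cycle φ γ φ-injective γ-injective h h⊆R p cycle = begin
    classify (h (point p))      ≡⟨ classify-cong (h (point p)) (lift φ (point p))
                                     (R-2-cycle f g m returns Rm) ⟩
    classify (lift φ (point p)) ≡⟨ cong classify (lift-point φ p) ⟩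
    classify (point (φ p))      ≡⟨ classify-point (φ p) ⟩
    φ p                         ∎
    where
    open ≡-Reasoning
    f  = lift-injection φ φ-injective
    g  = lift-injection γ γ-injective
    m  = proj₁ (h⊆R (point p))
    Rm = proj₂ (h⊆R (point p))
    returns : lift γ (lift φ (point p)) ≡ point p
    returns = begin
      lift γ (lift φ (point p)) ≡⟨ cong (lift γ) (lift-point φ p) ⟩
      lift γ (point (φ p))      ≡⟨ lift-point γ (φ p) ⟩
      point (γ (φ p))           ≡⟨ cong point cycle ⟩
      point p                   ∎

  -- Kleene codes and finite precision.

  module Codes (coding : List ℕ ↣ ℕ) where
    open Kleene coding

    -- The code waits for exactly 2 + n entries before it gives the nth entry of
    -- the value. Whether c is such a request, and its n, do not depend on F.
    Question : ℕ → Set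
    Question c = ∃[ n ] ∃[ z ] ⟨ n ∷ applyUpTo (ι z) (2 + n) ⟩ ≡ c

    -- The `z` in a question is just some point with the given prefix; `Modulus` makes the entry
    -- independent of this choice. Values are raised by one because 0 means that more input is
    -- awaited.
    answer : (X → X) → ∀ {c} → Dec (Question c) → ℕ
    answer F (yes (n , z , _)) = suc (ι (F z) n)
    answer F (no _)            = 0

    code : (X → X) → Baire
    code F c = answer F (em {Question c})

    isCode : ∀ F → Modulus F → IsCode (code F) F
    isCode F F-modulus z n = 2 + n , (subst (_> 0) (sym hit) (s≤s z≤n) , miss) , cong (_∸ 1) hit
      where
      hit : query (code F) (ι z) n (2 + n) ≡ suc (ι (F z) n)
      hit with em {Question ⟨ n ∷ applyUpTo (ι z) (2 + n) ⟩}
      ... | no ∄ = contradiction (n , z , refl) ∄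
      ... | yes (n′ , z′ , eq) with ∷-injective (Injection.injective coding eq)
      ...   | refl , eqs = cong suc (F-modulus z′ z n (applyUpTo-injective (2 + n) eqs))
      miss : ∀ j → j < 2 + n → ¬ (query (code F) (ι z) n j > 0)
      -- A question records 2 + n entries, so its length rules out a shorter prefix.
      miss j j<2+n pos with em {Question ⟨ n ∷ applyUpTo (ι z) j ⟩}
      ... | yes (n′ , z′ , eq) with ∷-injective (Injection.injective coding eq)
      ...   | refl , eqs = <⇒≢ j<2+n
        (trans (sym (length-applyUpTo (ι z) j))
          (trans (cong length (sym eqs)) (length-applyUpTo (ι z′) (2 + n))))

    -- The first `k` values of a code concern finitely many output positions, the same for every
    -- map. Hence `K` can be fixed before the perturbed maps, which depend on it, are chosen.
    code-cong : ∀ k → ∃[ K ] (∀ F F′ → (∀ z n → n ≤ K → ι (F z) n ≡ ι (F′ z) n) →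
                              code F ≈[ k ] code F′)
    code-cong k = proj₁ bound , λ F F′ F≈F′ c c<k → agree F F′ F≈F′ em (proj₂ bound c c<k)
      where
      outputIndex : ∀ {c} → Dec (Question c) → ℕ
      outputIndex (yes (n , _)) = n
      -- Any default serves: both codes give 0 at a non-question.
      outputIndex (no _)        = 0
      bound = uniform-bound {λ c K → outputIndex (em {Question c}) ≤ K}
                (λ K≤K′ n≤K → ≤-trans n≤K K≤K′) (λ _ → _ , ≤-refl) k
      agree : ∀ F F′ {K} → (∀ z n → n ≤ K → ι (F z) n ≡ ι (F′ z) n) →
              ∀ {c} (d : Dec (Question c)) → outputIndex d ≤ K → answer F d ≡ answer F′ d
      agree F F′ F≈F′ (yes (n , z , _)) n≤K = cong suc (F≈F′ z n n≤K)
      agree F F′ F≈F′ (no _)            _   = refl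

    least-agree : ∀ {s t k l} → LeastPositive s k → LeastPositive t l →
                  s ≈[ suc k ] t → s k ≡ t l
    least-agree {s} {t} {k} {l} (sk>0 , s-least) (tl>0 , t-least) s≈t with <-cmp k l
    ... | tri< k<l _ _ = contradiction (subst (_> 0) (s≈t k ≤-refl) sk>0) (t-least k k<l)
    ... | tri≈ _ refl _ = s≈t k ≤-refl
    ... | tri> _ _ l<k =
      contradiction (subst (_> 0) (sym (s≈t l (m<n⇒m<1+n l<k))) tl>0) (s-least l l<k)

    -- The side is entry 0 of the output, found after `k` entries of `ι z` and the 1 + k queries on
    -- its prefixes. `N` exceeds the arguments of these queries, so `e′` gives the same replies.
    local-output : ∀ e h → IsCode e h → ∀ z → ∃[ k ] ∃[ N ] (∀ z′ → ι z ≈[ k ] ι z′ →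
      ∀ e′ h′ → IsCode e′ h′ → e ≈[ N ] e′ → proj₁ (h z) ≡ proj₁ (h′ z′))
    local-output e h e-codes z with e-codes z 0
    ... | k , least , eq = k , proj₁ bound , agree
      where
      asked : ℕ → ℕ
      asked j = ⟨ 0 ∷ applyUpTo (ι z) j ⟩
      bound = uniform-bound {λ j N → asked j < N} (λ N≤N′ a<N → <-≤-trans a<N N≤N′)
                (λ _ → _ , ≤-refl) (suc k)
      agree : ∀ z′ → ι z ≈[ k ] ι z′ → ∀ e′ h′ → IsCode e′ h′ → e ≈[ proj₁ bound ] e′ →
              proj₁ (h z) ≡ proj₁ (h′ z′)
      agree z′ z≈z′ e′ h′ e′-codes e≈e′ with e′-codes z′ 0
      ... | l , least′ , eq′ = toℕ-injective
        (trans (sym eq) (trans (cong (_∸ 1) (least-agree least least′ same)) eq′))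
        where
        same : query e (ι z) 0 ≈[ suc k ] query e′ (ι z′) 0
        same j j<1+k = trans (e≈e′ (asked j) (proj₂ bound j j<1+k))
          (cong (λ qs → e′ ⟨ 0 ∷ qs ⟩)
            (applyUpTo-cong j λ i i<j → z≈z′ i (<-≤-trans i<j (s≤s⁻¹ j<1+k))))

    side-determined : ∀ e h → IsCode e h → ∃[ N ] (∀ z →
      ∀ e′ h′ → IsCode e′ h′ → e ≈[ N ] e′ → proj₁ (h z) ≡ proj₁ (h′ z))
    side-determined e h e-codes = compactness
      (λ N≤N′ q e′ h′ e′-codes e≈e′ → q e′ h′ e′-codes λ i i<N → e≈e′ i (<-≤-trans i<N N≤N′))
      (λ z → let k , N , q = local-output e h e-codes z in
        k , N , λ z′ z≈z′ e′ h′ e′-codes e≈e′ →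
          -- Taking `e` itself as the second code moves `h` from `z` to `z′`.
          trans (sym (q z′ z≈z′ e h e-codes λ _ _ → refl)) (q z′ z≈z′ e′ h′ e′-codes e≈e′))

-- Two perturbations of the translation.

theorem58 :
    ExcludedMiddle 0ℓ →
    (coding : List ℕ ↣ ℕ) →
    let open Kleene coding using (IsCode)
        open PartialContinuousMap
        open Setoid 2×ℕ∞ using (_≈_)
    in
    ¬ (Σ[ Φ ∈ PartialContinuousMap ]
         (∀ (f g : Injection 2×ℕ∞ 2×ℕ∞) →
          Continuous (Injection.to f) → Continuous (Injection.to g) →
          ∀ a b → IsCode a (Injection.to f) → IsCode b (Injection.to g) →
          Σ[ d ∈ ((a , b) ∈ Dom Φ) ]
          Σ[ h ∈ Inverse 2×ℕ∞ 2×ℕ∞ ]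
            (IsCode (proj₁ (apply Φ (a , b) d)) (Inverse.to h)
             × IsCode (proj₂ (apply Φ (a , b) d)) (Inverse.from h)
             × (∀ x y → y ≈ Inverse.to h x →
                  ∃[ m ] R (Injection.to f) (Injection.to g) m x y))))
theorem58 em coding (Φ , solve) =
  no-side-preserving-pair K (conj h₁.to) (conj h₁.from) (conj h₂.to)
    conj-inverse
    (λ {p} {q} → point-injective p q ∘ h₂-injective
                   ∘ classify-injective (h₂.to (point p)) (h₂.to (point q)))
    -- Both answers are compared with the one for the unperturbed pair.
    (λ p → trans (sym (side (point p) (e s₁) h₁.to (h-code s₁) (close s₁ (near₁ , λ _ _ → refl))))
                 (side (point p) (e s₂) h₂.to (h-code s₂) (close s₂ ((λ _ _ → refl) , near₂))))
    (λ p cycle →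
        trans (lift-2-cycle (skip K ∘ shift) id (shift-injective ∘ skip-injective K) id
                 h₁.to (h⊆R s₁) p cycle) cycle
      , lift-2-cycle shift (skip K) shift-injective (skip-injective K)
          h₂.to (h⊆R s₂) p cycle)
  where
  open Kleene coding
  open PartialContinuousMap Φ
  open Classical em
  open Codes coding

  conj : (X → X) → P → P
  conj h = classify ∘ h ∘ point

  codes : (P → P) → (P → P) → Baire × Baire
  codes φ γ = code (lift φ) , code (lift γ)

  record Solution (φ γ : P → P) : Set where
    constructor solution
    field
      dom    : codes φ γ ∈ Dom
      h      : Inverse 2×ℕ∞ 2×ℕ∞
    e : Baire
    e = proj₁ (apply (codes φ γ) dom)
    field
      h-code : IsCode e (Inverse.to h)
      h⊆R    : ∀ x → ∃[ m ] R (lift φ) (lift γ) m x (Inverse.to h x)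
  open Solution

  solve-lift : ∀ {φ γ} → (∀ {p q} → φ p ≡ φ q → p ≡ q) → (∀ {p q} → γ p ≡ γ q → p ≡ q) →
               Nonexpanding φ → Nonexpanding γ → Solution φ γ
  solve-lift {φ} {γ} φ-injective γ-injective φ-ne γ-ne
    with solve (lift-injection φ φ-injective) (lift-injection γ γ-injective)
           (continuous-lift φ φ-ne) (continuous-lift γ γ-ne)
           (code (lift φ)) (code (lift γ))
           (isCode (lift φ) (lift-modulus φ φ-ne)) (isCode (lift γ) (lift-modulus γ γ-ne))
  ... | d , h , h-code , _ , h⊆R = solution d h h-code λ x →
    h⊆R x (Inverse.to h x) (≈-refl {Inverse.to h x})

  s₀ = solve-lift {shift} {id} shift-injective id shift-nonexpanding id-nonexpanding
  -- Precisions are chosen backwards: `N` for the output code, `k` for the input codes by continuity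
  -- of `Φ`, and `K` for the maps.
  N    = proj₁ (side-determined (e s₀) (Inverse.to (h s₀)) (h-code s₀))
  side = proj₂ (side-determined (e s₀) (Inverse.to (h s₀)) (h-code s₀))
  k    = proj₁ (continuous (codes shift id) (dom s₀) N)
  K    = proj₁ (code-cong k)

  -- Both pairs have the composite `skip K ∘ shift` on `P`, hence the same fixed points. There the
  -- first `f` acts as the identity and the second as `shift`.
  s₁ = solve-lift {skip K ∘ shift} {id} (shift-injective ∘ skip-injective K) id
         (skip∘shift-nonexpanding K) id-nonexpanding
  s₂ = solve-lift {shift} {skip K} shift-injective (skip-injective K)
         shift-nonexpanding (skip-nonexpanding K)
  module h₁ = Inverse (h s₁)
  module h₂ = Inverse (h s₂)

  conj-inverse : ∀ p → conj h₁.to (conj h₁.from p) ≡ p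
  conj-inverse p = trans (classify-cong (h₁.to z) (point p) z↦p) (classify-point p)
    where
    z = point (conj h₁.from p)
    z↦p : h₁.to z ≈ point p
    z↦p = h₁.inverseˡ {point p} {z}
      (≈-sym {h₁.from (point p)} {z} (≈-point-classify (h₁.from (point p))))

  h₂-injective : ∀ {x y} → h₂.to x ≈ h₂.to y → x ≈ y
  h₂-injective {x} {y} eq = begin
    x                  ≈⟨ h₂.strictlyInverseʳ x ⟨
    h₂.from (h₂.to x)  ≈⟨ h₂.from-cong {h₂.to x} {h₂.to y} eq ⟩
    h₂.from (h₂.to y)  ≈⟨ h₂.strictlyInverseʳ y ⟩
    y                  ∎
    where open ≈-Reasoning

  close : ∀ {φ γ} (s : Solution φ γ) → codes shift id ≈²[ k ] codes φ γ →
          e s₀ ≈[ N ] e s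
  close s near = proj₁ (proj₂ (continuous (codes shift id) (dom s₀) N) _ (dom s) near)

  near₁ : code (lift shift) ≈[ k ] code (lift (skip K ∘ shift))
  near₁ = proj₂ (code-cong k) (lift shift) (lift (skip K ∘ shift)) λ z →
    ι-skip K (shift (classify z))

  near₂ : code (lift id) ≈[ k ] code (lift (skip K))
  near₂ = proj₂ (code-cong k) (lift id) (lift (skip K)) λ z → ι-skip K (classify z)
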